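{- If $G$ is a threshold graph, then $D(G)$ is equal to the size (number of vertices) of the largest component in the compact canonical decomposition of $G$.
   Context: All graphs are finite, simple and undirected. A labeling $\phi: V(G)\to\{1,\dots,c\}$ is distinguishing if for every non-trivial automorphism $\pi$ of $G$ there is a vertex $v$ with $\phi(v)\neq\phi(\pi(v))$. The distinguishing number $D(G)$ is the smallest $c$ such that $G$ has a distinguishing $c$-labeling. A threshold graph is a graph that can be constructed from the empty graph by repeatedly adding an isolated vertex or a dominating vertex (one adjacent to all the vertices already present). A graph is split if its vertex set can be partitioned as $A\cup B$ with $A$ inducing a complete graph and $B$ a stable set (one of $A,B$ may be empty); $(A,B)$ is a $KS$-partition, and $(G,A,B)$ denotes a split graph $G$ with a fixed $KS$-partition. If $V(G)\cap V(H)=\emptyset$, the composition $(G,A,B)\circ H$ is the graph with vertex set $V(G)\cup V(H)$ and edge set $E(G)\cup E(H)\cup\{uv: u\in A, v\in V(H)\}$. If $H$ is split with $KS$-partition $(C,D)$, then $(G,A,B)\circ(H,C,D)$ is the composition graph with $KS$-partition $(A\cup C,B\cup D)$; the operation is associative. A graph is decomposable if it equals $(G,A,B)\circ H$ with $G$ and $H$ each having at least one vertex; otherwise it is indecomposable. Canonical decomposition (Tyshkevich): every graph $G$ can be written as $(G_r,A_r,B_r)\circ\cdots\circ(G_1,A_1,B_1)\circ G_0$ with every $G_i$ indecomposable, and this is unique up to isomorphism (isomorphisms of triples respect the $KS$-partitions). A component is trivial if it has exactly one vertex. A trivial component $G_i$ with $i\ge 1$ has type $K_1$ if its vertex is in $A_i$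 and type $S_1$ if its vertex is in $B_i$. If $G_0$ and $G_1$ are both trivial, $G_0$ is given the type of $G_1$; if $G_0$ is trivial but $G_1$ is non-trivial or does not exist, $G_0$ is given no type and is left alone. Compact canonical decomposition: obtained from the canonical decomposition by replacing each maximal run of $m$ consecutive trivial components of type $K_1$ by the complete graph on those $m$ vertices with $KS$-partition (all vertices, $\emptyset$), and each maximal run of $m$ consecutive trivial components of type $S_1$ by the edgeless graph on those $m$ vertices with $KS$-partition ($\emptyset$, all vertices). (If the run includes the last component $G_0$, the result is the new last component.) -}

module Defs where

open import Data.Bool.Base using (Bool; true; false; if_then_else_; T)
open import Data.Bool.Properties using (T?)
open import Data.Empty using (⊥)
open import Data.Fin.Base using (Fin; zero)
import Data.Fin.Properties as Fin
open import Data.List.Base using (List; []; _∷_; map; foldr)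
open import Data.List.Extrema.Nat using (max)
open import Data.List.Relation.Unary.All using (All)
open import Data.Maybe.Base using (Maybe; just; nothing; maybe′)
open import Data.Nat.Base using (ℕ; suc; _+_; _≤_)
import Data.Nat.Properties as ℕ
open import Data.Product.Base using (_×_; _,_; Σ-syntax; ∃-syntax)
open import Data.Sum.Base using (_⊎_; inj₁; inj₂)
open import Data.Sum.Function.Propositional using (_⊎-↔_)
open import Data.Unit.Base using (⊤; tt)
open import Function.Base using (const)
open import Function.Bundles using (_↔_; _⇔_; Inverse)
open import Function.Properties.Inverse using (↔-sym; ↔-trans; ↔-refl)
open import Level using (0ℓ)
open import Relation.Binary.Core using (Rel)
open import Relation.Binary.Definitions using (Decidable; Symmetric; Irreflexive)
open import Relation.Binary.PropositionalEquality using (_≡_; _≢_; refl; sym; subst; ≢-sym)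
open import Relation.Nullary using (¬_; Dec; yes; no; does; ¬?)
open import Relation.Unary using (Pred; _∈_; _∉_)
import Relation.Unary as Unary

record Graph : Set₁ where
  field
    Vertex : Set
    order  : ℕ
    finite : Vertex ↔ Fin order
    Adj    : Rel Vertex 0ℓ
    adj?   : Decidable Adj
    symm   : Symmetric Adj
    irrefl : Irreflexive _≡_ Adj

open Graph public

infix 4 _≅_

record _≅_ (G H : Graph) : Set where
  field
    bijection : Vertex G ↔ Vertex H
  open Inverse bijection public using (to; from)
  field
    adjacency : ∀ u v → Adj G u v ⇔ Adj H (to u) (to v)

Automorphism : Graph → Set
Automorphism G = G ≅ G

NonTrivial : ∀ {G} → Automorphism G → Set
NonTrivial π = ¬ (∀ v → _≅_.to π v ≡ v)

Labeling : Graph → ℕ → Set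
Labeling G c = Vertex G → Fin c

Distinguishing : ∀ G {c} → Labeling G c → Set
Distinguishing G φ =
  ∀ (π : Automorphism G) → NonTrivial π → ∃[ v ] φ v ≢ φ (_≅_.to π v)

HasDistinguishingLabeling : Graph → ℕ → Set
HasDistinguishingLabeling G c = Σ[ φ ∈ Labeling G c ] Distinguishing G φ

-- IsDistinguishingNumber G c says D(G) = c.
IsDistinguishingNumber : Graph → ℕ → Set
IsDistinguishingNumber G c =
  HasDistinguishingLabeling G c ×
  (∀ c′ → HasDistinguishingLabeling G c′ → c ≤ c′)

-- The new vertex, inj₁ tt, is adjacent to every old one if the flag is true
-- and to none if it is false.
addVertex : Bool → Graph → Graph
addVertex b G = record
  { Vertex = ⊤ ⊎ Vertex G
  ; order  = 1 + order G
  ; finite = ↔-trans (↔-sym Fin.1↔⊤ ⊎-↔ finite G) (↔-sym Fin.+↔⊎)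
  ; Adj    = E
  ; adj?   = E?
  ; symm   = λ {u} {v} → E-sym {u} {v}
  ; irrefl = λ {u} → E-irrefl {u}
  }
  where
  E : Rel (⊤ ⊎ Vertex G) 0ℓ
  E (inj₁ _) (inj₁ _) = ⊥
  E (inj₁ _) (inj₂ _) = T b
  E (inj₂ _) (inj₁ _) = T b
  E (inj₂ u) (inj₂ v) = Adj G u v

  E? : Decidable E
  E? (inj₁ _) (inj₁ _) = no λ ()
  E? (inj₁ _) (inj₂ _) = T? b
  E? (inj₂ _) (inj₁ _) = T? b
  E? (inj₂ u) (inj₂ v) = adj? G u v

  E-sym : Symmetric E
  E-sym {inj₁ _} {inj₂ _} e = e
  E-sym {inj₂ _} {inj₁ _} e = e
  E-sym {inj₂ _} {inj₂ _} e = symm G e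

  E-irrefl : Irreflexive _≡_ E
  E-irrefl {inj₂ _} refl e = irrefl G refl e

addIsolated addDominating : Graph → Graph
addIsolated   = addVertex false
addDominating = addVertex true

data Threshold (G : Graph) : Set₁ where
  empty      : order G ≡ 0 → Threshold G
  isolated   : ∀ H → Threshold H → G ≅ addIsolated H → Threshold G
  dominating : ∀ H → Threshold H → G ≅ addDominating H → Threshold G

-- A triple (G, A, B) with B the complement of A.
record SplitGraph : Set₁ where
  field
    graph  : Graph
    A      : Pred (Vertex graph) 0ℓ
    A?     : Unary.Decidable A
    clique : ∀ u v → u ∈ A → v ∈ A → u ≢ v → Adj graph u v
    stable : ∀ u v → u ∉ A → v ∉ A → ¬ Adj graph u v

open SplitGraph public

infixr 6 _⊚_

_⊚_ : SplitGraph → Graph → Graph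
S ⊚ H = record
  { Vertex = Vertex G ⊎ Vertex H
  ; order  = order G + order H
  ; finite = ↔-trans (finite G ⊎-↔ finite H) (↔-sym Fin.+↔⊎)
  ; Adj    = E
  ; adj?   = E?
  ; symm   = λ {u} {v} → E-sym {u} {v}
  ; irrefl = λ {u} → E-irrefl {u}
  }
  where
  G = graph S

  E : Rel (Vertex G ⊎ Vertex H) 0ℓ
  E (inj₁ u) (inj₁ v) = Adj G u v
  E (inj₁ u) (inj₂ _) = u ∈ A S
  E (inj₂ _) (inj₁ v) = v ∈ A S
  E (inj₂ u) (inj₂ v) = Adj H u v

  E? : Decidable E
  E? (inj₁ u) (inj₁ v) = adj? G u v
  E? (inj₁ u) (inj₂ _) = A? S u
  E? (inj₂ _) (inj₁ v) = A? S v
  E? (inj₂ u) (inj₂ v) = adj? H u v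

  E-sym : Symmetric E
  E-sym {inj₁ _} {inj₁ _} e = symm G e
  E-sym {inj₁ _} {inj₂ _} e = e
  E-sym {inj₂ _} {inj₁ _} e = e
  E-sym {inj₂ _} {inj₂ _} e = symm H e

  E-irrefl : Irreflexive _≡_ E
  E-irrefl {inj₁ _} refl e = irrefl G refl e
  E-irrefl {inj₂ _} refl e = irrefl H refl e

NonEmpty : Graph → Set
NonEmpty G = 1 ≤ order G

Decomposable : Graph → Set₁
Decomposable G =
  Σ[ S ∈ SplitGraph ] Σ[ H ∈ Graph ]
    NonEmpty (graph S) × NonEmpty H × G ≅ S ⊚ H

Indecomposable : Graph → Set₁
Indecomposable G = ¬ Decomposable G

-- The components G_r , … , G₁ (in this order) followed by G₀.
record Components : Set₁ where
  constructor _▷_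
  field
    upper : List SplitGraph
    core  : Graph

open Components public

compose : Components → Graph
compose (Ss ▷ G₀) = foldr _⊚_ G₀ Ss

-- Components have at least one vertex; the exception is the empty graph, which
-- is its own only component.
record CanonicalDecomposition (G : Graph) : Set₁ where
  field
    components           : Components
    upper-nonEmpty       : All (λ S → NonEmpty (graph S)) (upper components)
    core-nonEmpty        : upper components ≢ [] → NonEmpty (core components)
    upper-indecomposable : All (λ S → Indecomposable (graph S)) (upper components)
    core-indecomposable  : Indecomposable (core components)
    isomorphism          : G ≅ compose components

open CanonicalDecomposition public

Trivial : Graph → Set
Trivial G = order G ≡ 1

trivial? : ∀ G → Dec (Trivial G)
trivial? G = order G ℕ.≟ 1

soleVertex : ∀ G → Trivial G → Vertex G
soleVertex G eq = Inverse.from (finite G) (subst Fin (sym eq) zero)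

data Type : Set where
  K₁ S₁ : Type

typeOf : SplitGraph → Maybe Type
typeOf S with trivial? (graph S)
... | no  _  = nothing
... | yes eq = just (if does (A? S (soleVertex (graph S) eq)) then K₁ else S₁)

-- `run t m` stands for m consecutive trivial components of type t, and
-- `single X` for a component without a type.
data Block (X : Set₁) : Set₁ where
  run    : Type → ℕ → Block X
  single : X → Block X

Blocks : Set₁
Blocks = List (Block SplitGraph) × Block Graph

-- G₀ as a block, given the type of G₁.
coreBlock : Maybe Type → Graph → Block Graph
coreBlock nothing  G₀ = single G₀
coreBlock (just t) G₀ = if does (trivial? G₀) then run t 1 else single G₀

lengthen : ∀ {X} → Type → Block X → Maybe (Block X)
lengthen K₁ (run K₁ m) = just (run K₁ (suc m))
lengthen S₁ (run S₁ m) = just (run S₁ (suc m))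
lengthen K₁ (run S₁ _) = nothing
lengthen S₁ (run K₁ _) = nothing
lengthen _  (single _) = nothing

-- Put a trivial component of type t in front: it joins the first block if that
-- is a run of type t, and starts a new run otherwise.
consTrivial : Type → Blocks → Blocks
consTrivial t ([]     , q) = maybe′ (λ q′ → [] , q′) (run t 1 ∷ [] , q) (lengthen t q)
consTrivial t (p ∷ ps , q) =
  maybe′ (λ p′ → p′ ∷ ps , q) (run t 1 ∷ p ∷ ps , q) (lengthen t p)

consComponent : SplitGraph → Blocks → Blocks
consComponent S (ps , q) =
  maybe′ (λ t → consTrivial t (ps , q)) (single S ∷ ps , q) (typeOf S)

blocks : Components → Blocks
blocks ([]           ▷ G₀) = [] , single G₀
blocks ((S ∷ [])     ▷ G₀) = consComponent S ([] , coreBlock (typeOf S) G₀)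
blocks ((S ∷ T ∷ Ss) ▷ G₀) = consComponent S (blocks ((T ∷ Ss) ▷ G₀))

completeGraph : ℕ → Graph
completeGraph m = record
  { Vertex = Fin m
  ; order  = m
  ; finite = ↔-refl
  ; Adj    = _≢_
  ; adj?   = λ u v → ¬? (u Fin.≟ v)
  ; symm   = ≢-sym
  ; irrefl = λ u≡v u≢v → u≢v u≡v
  }

edgelessGraph : ℕ → Graph
edgelessGraph m = record
  { Vertex = Fin m
  ; order  = m
  ; finite = ↔-refl
  ; Adj    = λ _ _ → ⊥
  ; adj?   = λ _ _ → no λ ()
  ; symm   = λ ()
  ; irrefl = λ _ ()
  }

runComponent : Type → ℕ → SplitGraph
runComponent K₁ m = record
  { graph  = completeGraph m
  ; A      = const ⊤
  ; A?     = λ _ → yes tt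
  ; clique = λ _ _ _ _ u≢v → u≢v
  ; stable = λ _ _ u∉A _ _ → u∉A tt
  }
runComponent S₁ m = record
  { graph  = edgelessGraph m
  ; A      = const ⊥
  ; A?     = λ _ → no λ ()
  ; clique = λ _ _ ()
  ; stable = λ _ _ _ _ ()
  }

upperComponent : Block SplitGraph → SplitGraph
upperComponent (run t m)  = runComponent t m
upperComponent (single S) = S

coreComponent : Block Graph → Graph
coreComponent (run t m)  = graph (runComponent t m)
coreComponent (single G) = G

compactCanonicalDecomposition : ∀ {G} → CanonicalDecomposition G → Components
compactCanonicalDecomposition d =
  let ps , q = blocks (components d)
  in  map upperComponent ps ▷ coreComponent q

largestComponentSize : Components → ℕ
largestComponentSize (Ss ▷ G₀) = max (order G₀) (map (λ S → order (graph S)) Ss)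

{-# OPTIONS --safe #-}

-- A vertex is extreme of type K₁ (S₁) if it is adjacent to all (none) of the
-- others.  Every nonempty induced subgraph of a threshold graph has an extreme
-- vertex, so an indecomposable one has at most one vertex: all components are
-- trivial, and the compact components are the maximal runs of a word in K₁, S₁.
--
-- The vertices of a run are pairwise twins, so a distinguishing labeling is
-- injective on each run.  Conversely, number the vertices within each run.  The
-- extreme vertices of the type of the outermost vertex are those of the first
-- run, so an automorphism that preserves the labels fixes the outermost vertex,
-- and then by induction all the others.

module Submission where

open import Defs

open import Data.Bool.Base using (Bool; true; false; T)
open import Data.Bool.Properties using (T?)
open import Data.Fin.Base using (Fin; zero; suc; fromℕ<)
open import Data.Fin.Permutation using (transpose)
import Data.Fin.Properties as Fin
open import Data.List.Base using (List; []; _∷_; map)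
open import Data.List.Extrema.Nat using (max; ⊥≤max; xs≤max; max≤v⁺)
open import Data.List.Relation.Binary.Pointwise.Base using (Pointwise; []; _∷_)
open import Data.List.Relation.Unary.All as All using (All; []; _∷_)
open import Data.Maybe.Base using (just)
open import Data.Nat.Base using (ℕ; zero; suc; _≤_; _<_; _⊔_; z≤n; s≤s; z<s)
import Data.Nat.Properties as ℕ
open import Data.Product.Base using (Σ-syntax; ∃; ∃₂; _×_; _,_; proj₁; proj₂)
open import Data.Sum.Base using (_⊎_; inj₁; inj₂)
open import Data.Sum.Function.Propositional using (_⊎-↔_)
open import Data.Sum.Properties using (inj₂-injective)
open import Data.Unit.Base using (⊤; tt)
open import Function.Base using (_∘_; id)
open import Function.Bundles using
  (_↔_; _⇔_; Inverse; Equivalence; Injection; mk⇔; mk↔ₛ′)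
open import Function.Construct.Composition using (_⇔-∘_)
open import Function.Construct.Identity using (⇔-id)
open import Function.Construct.Symmetry using (⇔-sym)
open import Function.Definitions using (Injective)
open import Function.Properties.Inverse using (↔-refl; ↔-sym; ↔-trans; ↔⇒↣)
open import Level using (0ℓ)
open import Relation.Binary.Definitions using (DecidableEquality)
open import Relation.Binary.PropositionalEquality
open import Relation.Nullary using
  (Dec; yes; no; ¬?; contradiction; decidable-stable)
open import Relation.Nullary.Decidable using (dec-true; map′)
open import Relation.Unary using (Pred; _∈_)
import Relation.Unary as Unary

-- Bijections, equivalences and maxima.

↔-injective : ∀ {A B : Set} (f : A ↔ B) → Injective _≡_ _≡_ (Inverse.to f)
↔-injective f = Injection.injective (↔⇒↣ f)

⇔-refl : ∀ {A : Set} → A ⇔ A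
⇔-refl = ⇔-id _

⇔-trans : ∀ {A B C : Set} → A ⇔ B → B ⇔ C → A ⇔ C
⇔-trans f g = g ⇔-∘ f

≡⇒⇔ : ∀ {A B : Set} → A ≡ B → A ⇔ B
≡⇒⇔ refl = ⇔-refl

≢inj₁⇒inj₂ : ∀ {A : Set} (x : ⊤ ⊎ A) → x ≢ inj₁ tt → ∃ λ y → x ≡ inj₂ y
≢inj₁⇒inj₂ (inj₁ tt) x≢ = contradiction refl x≢
≢inj₁⇒inj₂ (inj₂ y)  _  = y , refl

max-∷ : ∀ b x xs → max b (x ∷ xs) ≡ x ⊔ max b xs
max-∷ b x xs = ℕ.≤-antisym
  (max≤v⁺ {xs = x ∷ xs}
    (ℕ.≤-trans (⊥≤max b xs) (ℕ.m≤n⊔m x _))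
    (ℕ.m≤m⊔n x _ ∷ All.map (λ y≤ → ℕ.≤-trans y≤ (ℕ.m≤n⊔m x _)) (xs≤max b xs)))
  (ℕ.⊔-lub (All.head ub) (max≤v⁺ {xs = xs} (⊥≤max b (x ∷ xs)) (All.tail ub)))
  where ub = xs≤max b (x ∷ xs)

-- Finite graphs and isomorphisms

vertex≟ : ∀ G → DecidableEquality (Vertex G)
vertex≟ G = Fin.inj⇒≟ (↔⇒↣ (finite G))

anyVertex? : ∀ G {P : Pred (Vertex G) 0ℓ} → Unary.Decidable P → Dec (∃ P)
anyVertex? G {P} P? = map′
  (λ (i , p) → from i , p)
  (λ (v , p) → to v , subst P (sym (strictlyInverseʳ v)) p)
  (Fin.any? (P? ∘ from))
  where open Inverse (finite G)

subsingleton : ∀ G → order G ≤ 1 → (u v : Vertex G) → u ≡ v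
subsingleton G ≤1 u v = ↔-injective (finite G) (go ≤1 _ _)
  where
  go : ∀ {n} → n ≤ 1 → (i j : Fin n) → i ≡ j
  go (s≤s z≤n) zero zero = refl

≅-sym : ∀ {G H} → G ≅ H → H ≅ G
≅-sym {G} {H} i = record
  { bijection = ↔-sym bijection
  ; adjacency = λ u v → ⇔-trans
      (≡⇒⇔ (sym (cong₂ (Adj H) (strictlyInverseˡ u) (strictlyInverseˡ v))))
      (⇔-sym (adjacency (from u) (from v)))
  }
  where open _≅_ i
        open Inverse bijection using (strictlyInverseˡ)

≅-trans : ∀ {G H K} → G ≅ H → H ≅ K → G ≅ K
≅-trans i j = record
  { bijection = ↔-trans (_≅_.bijection i) (_≅_.bijection j)
  ; adjacency = λ u v →
      ⇔-trans (_≅_.adjacency i u v) (_≅_.adjacency j (_≅_.to i u) (_≅_.to i v))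
  }

-- An automorphism of `G` is tested through its conjugate on `H`, which is trivial only if the
-- original is.
hasDistinguishingLabeling-≅ : ∀ {G H c} → G ≅ H →
  HasDistinguishingLabeling H c → HasDistinguishingLabeling G c
hasDistinguishingLabeling-≅ {G} i (φ , dist) = φ ∘ to , λ π π≢id →
  let v , φv≢ = dist (≅-trans (≅-sym i) (≅-trans π i)) λ conj≡id →
        π≢id λ v → ↔-injective bijection
          (trans (cong (to ∘ _≅_.to π) (sym (strictlyInverseʳ v))) (conj≡id (to v)))
  in  from v , λ eq → φv≢ (trans (cong φ (sym (strictlyInverseˡ v))) eq)
  where open _≅_ i
        open Inverse bijection using (strictlyInverseˡ; strictlyInverseʳ)

isDistinguishingNumber-≅ : ∀ {G H c} → G ≅ H →
  IsDistinguishingNumber H c → IsDistinguishingNumber G c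
isDistinguishingNumber-≅ i (has , least) =
  hasDistinguishingLabeling-≅ i has ,
  λ c′ → least c′ ∘ hasDistinguishingLabeling-≅ (≅-sym i)

-- `Distinguishing` asks for an explicit relabeled vertex. Since labels are decidable and vertices
-- finite, a search finds one or shows that all labels are preserved.
distinguishing-if-rigid : ∀ {G c} (φ : Labeling G c) →
  (∀ (π : Automorphism G) → (∀ v → φ v ≡ φ (_≅_.to π v)) → ∀ v → _≅_.to π v ≡ v) →
  Distinguishing G φ
distinguishing-if-rigid {G} φ rigid π π≢id
  with anyVertex? G (λ v → ¬? (φ v Fin.≟ φ (_≅_.to π v)))
... | yes found = found
... | no  none  = contradiction
  (rigid π λ v → decidable-stable (φ v Fin.≟ φ (_≅_.to π v)) λ φv≢ → none (v , φv≢))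
  π≢id

-- Serves the decomposition that consists of a core alone. The empty graph is included, with value
-- 0.
isDistinguishingNumber-order≤1 : ∀ G → order G ≤ 1 →
  IsDistinguishingNumber G (order G)
isDistinguishingNumber-order≤1 G ≤1 =
  (to , λ π π≢id → contradiction (λ v → subsingleton G ≤1 _ v) π≢id) ,
  λ c′ (φ , _) → Fin.injective⇒≤ {f = φ ∘ from} λ {i} {j} _ →
    ↔-injective (↔-sym (finite G)) (subsingleton G ≤1 (from i) (from j))
  where open Inverse (finite G)

-- Twins

Twins : ∀ G → Vertex G → Vertex G → Set
Twins G u v = ∀ x → x ≢ u → x ≢ v → Adj G u x ⇔ Adj G v x

module _ {A : Set} (u v : A) where

  -- The transposition of `u` and `v` as a relation: proofs can match on its cases instead of on
  -- equality tests. It stays single-valued even if `u` and `v` coincide.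
  data Swapped : A → A → Set where
    left  : Swapped u v
    right : Swapped v u
    other : ∀ {x} → x ≢ u → x ≢ v → Swapped x x

  swapped-unique : ∀ {x y z} → Swapped x y → Swapped x z → y ≡ z
  swapped-unique left          left          = refl
  swapped-unique left          right         = refl
  swapped-unique left          (other u≢u _) = contradiction refl u≢u
  swapped-unique right         left          = refl
  swapped-unique right         right         = refl
  swapped-unique right         (other _ v≢v) = contradiction refl v≢v
  swapped-unique (other u≢u _) left          = contradiction refl u≢u
  swapped-unique (other _ v≢v) right         = contradiction refl v≢v
  swapped-unique (other _ _)   (other _ _)   = refl

  swapped-sym : ∀ {x y} → Swapped x y → Swapped y x
  swapped-sym left            = right
  swapped-sym right           = left
  swapped-sym (other x≢u x≢v) = other x≢u x≢v

  module Swap (_≟_ : DecidableEquality A) where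

    swap : ∀ x → ∃ (Swapped x)
    swap x with x ≟ u | x ≟ v
    ... | yes refl | _        = v , left
    ... | no _     | yes refl = u , right
    ... | no x≢u   | no x≢v   = x , other x≢u x≢v

    swap-↔ : A ↔ A
    swap-↔ = mk↔ₛ′ (proj₁ ∘ swap) (proj₁ ∘ swap) involutive involutive
      where
      involutive : ∀ x → proj₁ (swap (proj₁ (swap x))) ≡ x
      involutive x = swapped-unique
        (proj₂ (swap (proj₁ (swap x)))) (swapped-sym (proj₂ (swap x)))

module _ {G} {u v : Vertex G} (twins : Twins G u v) where

  open Swap u v (vertex≟ G)

  -- Twins are constrained only at third vertices; the pair itself is handled by symmetry, and a
  -- repeated vertex by irreflexivity. The swap is an involution, so this direction also yields the
  -- converse.
  swapped-adj : ∀ {x x′ y y′} → Swapped u v x x′ → Swapped u v y y′ →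
                Adj G x y → Adj G x′ y′
  swapped-adj left            left            e = contradiction e (irrefl G refl)
  swapped-adj left            right           e = symm G e
  swapped-adj left            (other y≢u y≢v) e = Equivalence.to (twins _ y≢u y≢v) e
  swapped-adj right           left            e = symm G e
  swapped-adj right           right           e = contradiction e (irrefl G refl)
  swapped-adj right           (other y≢u y≢v) e = Equivalence.from (twins _ y≢u y≢v) e
  swapped-adj (other x≢u x≢v) left            e =
    symm G (Equivalence.to (twins _ x≢u x≢v) (symm G e))
  swapped-adj (other x≢u x≢v) right           e =
    symm G (Equivalence.from (twins _ x≢u x≢v) (symm G e))
  swapped-adj (other _ _)     (other _ _)     e = e

  twinSwap : Automorphism G
  twinSwap = record
    { bijection = swap-↔
    ; adjacency = λ x y → let x⇄ = proj₂ (swap x) ; y⇄ = proj₂ (swap y) in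
        mk⇔ (swapped-adj x⇄ y⇄)
            (swapped-adj (swapped-sym u v x⇄) (swapped-sym u v y⇄))
    }

  -- Otherwise `twinSwap` would be a nontrivial automorphism that preserves every label.
  twins-distinguished : ∀ {c} (φ : Labeling G c) → Distinguishing G φ →
                        φ u ≡ φ v → u ≡ v
  twins-distinguished φ dist φu≡φv = decidable-stable (vertex≟ G u v) λ u≢v →
    let x , φx≢ = dist twinSwap λ fixed →
          u≢v (trans (sym (fixed u)) (swapped-unique u v (proj₂ (swap u)) left))
    in  φx≢ (label-preserved (proj₂ (swap x)))
    where
    label-preserved : ∀ {x y} → Swapped u v x y → φ x ≡ φ y
    label-preserved left        = φu≡φv
    label-preserved right       = sym φu≡φv
    label-preserved (other _ _) = refl

TwinFamily : ℕ → Graph → Set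
TwinFamily m G = Σ[ e ∈ (Fin m → Vertex G) ]
  Injective _≡_ _≡_ e × (∀ i j → Twins G (e i) (e j))

twinFamily-bound : ∀ {m c G} → TwinFamily m G → HasDistinguishingLabeling G c → m ≤ c
twinFamily-bound {G = G} (e , e-inj , twins) (φ , dist) =
  Fin.injective⇒≤ {f = φ ∘ e} λ {i} {j} eq →
    e-inj (twins-distinguished {G} (twins i j) φ dist eq)

-- Extreme vertices

dominates : Type → Bool
dominates K₁ = true
dominates S₁ = false

dominates-injective : ∀ {s t} → T (dominates s) ⇔ T (dominates t) → s ≡ t
dominates-injective {K₁} {K₁} _   = refl
dominates-injective {K₁} {S₁} iff = contradiction (Equivalence.to iff tt) id
dominates-injective {S₁} {K₁} iff = contradiction (Equivalence.from iff tt) id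
dominates-injective {S₁} {S₁} _   = refl

-- In a one-vertex graph the condition is vacuous, so that vertex is extreme of both types. This
-- lets the core join a run of either type.
Extreme : Type → ∀ G → Vertex G → Set
Extreme t G v = ∀ u → u ≢ v → Adj G v u ⇔ T (dominates t)

extreme-≅ : ∀ {t G H v} (i : G ≅ H) → Extreme t G v → Extreme t H (_≅_.to i v)
extreme-≅ {H = H} {v} i ext u u≢ = ⇔-trans
  (⇔-trans (≡⇒⇔ (cong (Adj H (to v)) (sym (strictlyInverseˡ u))))
           (⇔-sym (adjacency v (from u))))
  (ext (from u) λ eq → u≢ (trans (sym (strictlyInverseˡ u)) (cong to eq)))
  where open _≅_ i
        open Inverse bijection using (strictlyInverseˡ)

extreme-inner : ∀ {t b G v} → Extreme t (addVertex b G) (inj₂ v) → Extreme t G v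
extreme-inner ext u u≢v = ext (inj₂ u) (u≢v ∘ inj₂-injective)

extreme-new : ∀ {t G} → Extreme t (addVertex (dominates t) G) (inj₁ tt)
extreme-new (inj₁ tt) u≢ = contradiction refl u≢
extreme-new (inj₂ u)  _  = ⇔-refl

extreme-old : ∀ {t G v} → Extreme t G v → Extreme t (addVertex (dominates t) G) (inj₂ v)
extreme-old ext (inj₁ tt) _  = ⇔-refl
extreme-old ext (inj₂ u)  u≢ = ext u (u≢ ∘ cong inj₂)

ExtremeFamily : Type → ℕ → Graph → Set
ExtremeFamily t m G = Σ[ e ∈ (Fin m → Vertex G) ]
  Injective _≡_ _≡_ e × (∀ i → Extreme t G (e i))

extremeFamily-new : ∀ {t m G} → ExtremeFamily t m G →
                    ExtremeFamily t (suc m) (addVertex (dominates t) G)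
extremeFamily-new {t} {m} {G} (e , e-inj , ext) = e′ , e′-inj , ext′
  where
  e′ : Fin (suc m) → ⊤ ⊎ Vertex G
  e′ zero    = inj₁ tt
  e′ (suc i) = inj₂ (e i)

  e′-inj : Injective _≡_ _≡_ e′
  e′-inj {zero}  {zero}  _  = refl
  e′-inj {suc i} {suc j} eq = cong suc (e-inj (inj₂-injective eq))

  ext′ : ∀ i → Extreme t (addVertex (dominates t) G) (e′ i)
  ext′ zero    = extreme-new {t} {G}
  ext′ (suc i) = extreme-old {t} {G} (ext i)

extremeFamily⇒twinFamily : ∀ {t m G} → ExtremeFamily t m G → TwinFamily m G
extremeFamily⇒twinFamily (e , e-inj , ext) =
  e , e-inj , λ i j x x≢ei x≢ej → ⇔-trans (ext i x x≢ei) (⇔-sym (ext j x x≢ej))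

-- The new vertex treats all old vertices alike, so it cannot separate twins.
twinFamily-old : ∀ {b m G} → TwinFamily m G → TwinFamily m (addVertex b G)
twinFamily-old {b} {G = G} (e , e-inj , twins) =
  inj₂ ∘ e , e-inj ∘ inj₂-injective , twins′
  where
  twins′ : ∀ i j → Twins (addVertex b G) (inj₂ (e i)) (inj₂ (e j))
  twins′ i j (inj₁ tt) _   _   = ⇔-refl
  twins′ i j (inj₂ x)  x≢i x≢j = twins i j x (x≢i ∘ cong inj₂) (x≢j ∘ cong inj₂)

-- Indecomposable induced subgraphs of threshold graphs

infix 4 _⊑_

record _⊑_ (H G : Graph) : Set where
  field
    embed           : Vertex H → Vertex G
    embed-injective : Injective _≡_ _≡_ embed
    embed-adjacency : ∀ u v → Adj H u v ⇔ Adj G (embed u) (embed v)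

open _⊑_

⊑-trans : ∀ {G H K} → G ⊑ H → H ⊑ K → G ⊑ K
⊑-trans f g = record
  { embed           = embed g ∘ embed f
  ; embed-injective = embed-injective f ∘ embed-injective g
  ; embed-adjacency = λ u v → ⇔-trans (embed-adjacency f u v) (embed-adjacency g _ _)
  }

≅⇒⊑ : ∀ {G H} → G ≅ H → G ⊑ H
≅⇒⊑ i = record
  { embed           = to
  ; embed-injective = ↔-injective bijection
  ; embed-adjacency = adjacency
  }
  where open _≅_ i
        open Inverse bijection using (strictlyInverseˡ; strictlyInverseʳ)

⊚-left : ∀ S H → graph S ⊑ S ⊚ H
⊚-left S H = record
  { embed           = inj₁
  ; embed-injective = λ { refl → refl }
  ; embed-adjacency = λ _ _ → ⇔-refl
  }

⊚-right : ∀ S H → H ⊑ S ⊚ H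
⊚-right S H = record
  { embed           = inj₂
  ; embed-injective = inj₂-injective
  ; embed-adjacency = λ _ _ → ⇔-refl
  }

⊑-avoiding-new : ∀ {b H G} (f : H ⊑ addVertex b G) →
                 (∀ v → embed f v ≢ inj₁ tt) → H ⊑ G
⊑-avoiding-new {b} {H} {G} f avoids = record
  { embed           = proj₁ ∘ old
  ; embed-injective = λ {u} {v} eq → embed-injective f
      (trans (proj₂ (old u)) (trans (cong inj₂ eq) (sym (proj₂ (old v)))))
  ; embed-adjacency = λ u v → ⇔-trans (embed-adjacency f u v)
      (≡⇒⇔ (cong₂ (Adj (addVertex b G)) (proj₂ (old u)) (proj₂ (old v))))
  }
  where
  old : ∀ v → ∃ λ w → embed f v ≡ inj₂ w
  old v = ≢inj₁⇒inj₂ (embed f v) (avoids v)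

-- If the new vertex is in the image of `H`, its preimage is extreme of type `t`. If not, `H`
-- already embeds into the old graph and the induction hypothesis `rec` applies.
extremeVertex-step : ∀ {G H} t → (H ⊑ G → ∃₂ λ s v → Extreme s H v) →
  H ⊑ addVertex (dominates t) G → ∃₂ λ s v → Extreme s H v
extremeVertex-step {G} {H} t rec f
  with anyVertex? H (λ v → vertex≟ (addVertex (dominates t) G) (embed f v) (inj₁ tt))
... | no  none         = rec (⊑-avoiding-new f λ v eq → none (v , eq))
... | yes (v , fv≡new) = t , v , λ u u≢v →
  let w , fu≡old = ≢inj₁⇒inj₂ (embed f u) λ fu≡new →
        u≢v (embed-injective f (trans fu≡new (sym fv≡new)))
  in  ⇔-trans (embed-adjacency f v u)
        (≡⇒⇔ (cong₂ (Adj (addVertex (dominates t) G)) fv≡new fu≡old))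

-- Induction on the construction of `G`. The subgraph `H` is arbitrary because the components of a
-- decomposition are known only as induced subgraphs.
threshold⇒extremeVertex : ∀ {G H} → Threshold G → H ⊑ G → NonEmpty H →
                          ∃₂ λ t v → Extreme t H v
threshold⇒extremeVertex {G} {H} (empty order≡0) f nonEmpty =
  contradiction
    (subst Fin order≡0
      (Inverse.to (finite G) (embed f (Inverse.from (finite H) (fromℕ< nonEmpty)))))
    Fin.¬Fin0
threshold⇒extremeVertex (isolated H′ thr i) f nonEmpty = extremeVertex-step S₁
  (λ g → threshold⇒extremeVertex thr g nonEmpty) (⊑-trans f (≅⇒⊑ i))
threshold⇒extremeVertex (dominating H′ thr i) f nonEmpty = extremeVertex-step K₁
  (λ g → threshold⇒extremeVertex thr g nonEmpty) (⊑-trans f (≅⇒⊑ i))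

point : Type → SplitGraph
point t = record
  { graph  = completeGraph 1
  ; A      = λ _ → T (dominates t)
  ; A?     = λ _ → T? (dominates t)
  ; clique = λ _ _ _ _ u≢v → u≢v
  ; stable = λ { zero zero _ _ u≢u → u≢u refl }
  }

-- The extreme vertex splits off as an outer component: its adjacency to the rest is constant, as a
-- composition requires.
extreme⇒decomposable : ∀ {t} G {v} → Extreme t G v → 2 ≤ order G → Decomposable G
extreme⇒decomposable {t} G {v} ext 2≤ = go (finite G) 2≤
  where
  -- The order becomes a variable here so that it can be matched as `suc (suc n)`.
  go : ∀ {n} → Vertex G ↔ Fin n → 2 ≤ n → Decomposable G
  go {suc zero}    _    (s≤s ())
  go {suc (suc n)} enum _ = point t , rest , s≤s z≤n , s≤s z≤n , ≅-sym record
    { bijection = split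
    ; adjacency = adj
    }
    where
    -- The enumeration is rearranged so that v comes first.
    split : (Fin 1 ⊎ Fin (suc n)) ↔ Vertex G
    split = ↔-sym
      (↔-trans enum (↔-trans (transpose (Inverse.to enum v) zero) (Fin.+↔⊎ {1})))

    open Inverse split using (to)

    first : to (inj₁ zero) ≡ v
    -- The inverse transposition sends `zero` to `Inverse.to enum v` by computation, which leaves
    -- only the inverse law of `enum`.
    first = Inverse.strictlyInverseʳ enum v

    rest : Graph
    rest = record
      { Vertex = Fin (suc n)
      ; order  = suc n
      ; finite = ↔-refl
      ; Adj    = λ i j → Adj G (to (inj₂ i)) (to (inj₂ j))
      ; adj?   = λ i j → adj? G (to (inj₂ i)) (to (inj₂ j))
      ; symm   = symm G
      ; irrefl = λ { refl → irrefl G refl }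
      }

    across : ∀ j → T (dominates t) ⇔ Adj G (to (inj₁ zero)) (to (inj₂ j))
    across j = ⇔-sym (subst (Extreme t G) (sym first) ext (to (inj₂ j))
      λ eq → contradiction (↔-injective split {inj₂ j} {inj₁ zero} eq) λ ())

    adj : ∀ x y → Adj (point t ⊚ rest) x y ⇔ Adj G (to x) (to y)
    adj (inj₁ zero) (inj₁ zero) =
      mk⇔ (contradiction refl) (λ e → contradiction e (irrefl G refl))
    adj (inj₁ zero) (inj₂ j)    = across j
    adj (inj₂ i)    (inj₁ zero) = ⇔-trans (across i) (mk⇔ (symm G) (symm G))
    adj (inj₂ i)    (inj₂ j)    = ⇔-refl

indecomposable⇒order≤1 : ∀ {G H} → Threshold G → H ⊑ G → Indecomposable H → order H ≤ 1
indecomposable⇒order≤1 {H = H} thr f indec = ℕ.≮⇒≥ λ 2≤ →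
  let _ , _ , ext = threshold⇒extremeVertex thr f (ℕ.<⇒≤ 2≤)
  in  indec (extreme⇒decomposable H ext 2≤)

-- An embedding into the fixed graph `G` survives the removal of the outer component, so the
-- recursion never has to show that the remaining composition is threshold.
components-order≤1 : ∀ {G} Ss G₀ → Threshold G → compose (Ss ▷ G₀) ⊑ G →
  All (λ S → Indecomposable (graph S)) Ss → Indecomposable G₀ →
  All (λ S → order (graph S) ≤ 1) Ss × order G₀ ≤ 1
components-order≤1 []       G₀ thr f []           indec₀ =
  [] , indecomposable⇒order≤1 thr f indec₀
components-order≤1 (S ∷ Ss) G₀ thr f (indec ∷ is) indec₀ =
  let ≤1s , ≤1 = components-order≤1 Ss G₀ thr (⊑-trans (⊚-right S _) f) is indec₀
  in  indecomposable⇒order≤1 thr (⊑-trans (⊚-left S _) f) indec ∷ ≤1s , ≤1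

-- The threshold graph of a word

-- The head of the word is the outermost vertex. The core is the base vertex and has no letter, so
-- there is one vertex more than there are letters.
wordGraph : List Type → Graph
wordGraph []      = completeGraph 1
wordGraph (t ∷ w) = addVertex (dominates t) (wordGraph w)

-- The innermost vertex belongs to a run of either type.
leadingRun : Type → List Type → ℕ
leadingRun _  []       = 1
leadingRun K₁ (K₁ ∷ w) = suc (leadingRun K₁ w)
leadingRun S₁ (S₁ ∷ w) = suc (leadingRun S₁ w)
leadingRun K₁ (S₁ ∷ w) = 0
leadingRun S₁ (K₁ ∷ w) = 0

leadingRun-∷ : ∀ t w → leadingRun t (t ∷ w) ≡ suc (leadingRun t w)
leadingRun-∷ K₁ w = refl
leadingRun-∷ S₁ w = refl

-- The maximum is over all suffixes; one that starts inside a run contributes only a smaller number.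
longestRun : List Type → ℕ
longestRun []      = 1
longestRun (t ∷ w) = leadingRun t (t ∷ w) ⊔ longestRun w

extremeFamily : ∀ t w → ExtremeFamily t (leadingRun t w) (wordGraph w)
extremeFamily t  []       = id , id , λ { zero zero u≢u → contradiction refl u≢u }
extremeFamily K₁ (K₁ ∷ w) = extremeFamily-new {K₁} (extremeFamily K₁ w)
extremeFamily S₁ (S₁ ∷ w) = extremeFamily-new {S₁} (extremeFamily S₁ w)
extremeFamily K₁ (S₁ ∷ w) = (λ ()) , (λ {}) , λ ()
extremeFamily S₁ (K₁ ∷ w) = (λ ()) , (λ {}) , λ ()

-- The maximum is attained either by the leading run, whose vertices are extreme of one type, or
-- further in, where twins remain twins.
longestRun-twins : ∀ w → TwinFamily (longestRun w) (wordGraph w)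
longestRun-twins []      =
  extremeFamily⇒twinFamily {K₁} {G = wordGraph []} (extremeFamily K₁ [])
longestRun-twins (t ∷ w) with ℕ.⊔-sel (leadingRun t (t ∷ w)) (longestRun w)
... | inj₁ eq = subst (λ m → TwinFamily m (wordGraph (t ∷ w))) (sym eq)
  (extremeFamily⇒twinFamily {t} {G = wordGraph (t ∷ w)} (extremeFamily t (t ∷ w)))
... | inj₂ eq = subst (λ m → TwinFamily m (wordGraph (t ∷ w))) (sym eq)
  (twinFamily-old (longestRun-twins w))

-- A labeling preserved only by the identity.

label : ∀ w → Vertex (wordGraph w) → ℕ
label []      _        = 0
-- This counts the vertices further in within the same run. The base vertex, labeled 0, is counted
-- if the run reaches it.
label (t ∷ w) (inj₁ _) = leadingRun t w
label (t ∷ w) (inj₂ v) = label w v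

label<longestRun : ∀ w v → label w v < longestRun w
label<longestRun []      _        = z<s
label<longestRun (t ∷ w) (inj₁ _) =
  ℕ.≤-trans (ℕ.≤-reflexive (sym (leadingRun-∷ t w))) (ℕ.m≤m⊔n _ _)
label<longestRun (t ∷ w) (inj₂ v) = ℕ.≤-trans (label<longestRun w v) (ℕ.m≤n⊔m _ _)

innermost : ∀ w → Vertex (wordGraph w)
innermost []      = zero
innermost (t ∷ w) = inj₂ (innermost w)

-- One adjacency reveals the type: the outermost vertex is tested against `innermost`, any other
-- vertex against the outermost one.
extreme⇒head : ∀ {s t} w v → Extreme t (wordGraph (s ∷ w)) v → s ≡ t
extreme⇒head w (inj₁ tt) ext = dominates-injective (ext (inj₂ (innermost w)) λ ())
extreme⇒head w (inj₂ v)  ext = dominates-injective (ext (inj₁ tt) λ ())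

-- The bound is the label that a new outermost vertex of type `t` would get. By `extreme⇒head` the
-- vertex lies in a word starting with `t`, and it is either outermost there or extreme further in.
extreme⇒label< : ∀ t w v → Extreme t (wordGraph w) v → label w v < leadingRun t w
extreme⇒label< t []      v ext = z<s
extreme⇒label< t (s ∷ w) v ext with extreme⇒head w v ext
extreme⇒label< t (t ∷ w) (inj₁ tt) ext | refl =
  ℕ.≤-reflexive (sym (leadingRun-∷ t w))
extreme⇒label< t (t ∷ w) (inj₂ v)  ext | refl = ℕ.≤-trans
  (ℕ.m≤n⇒m≤1+n (extreme⇒label< t w v (extreme-inner {t} {G = wordGraph w} ext)))
  (ℕ.≤-reflexive (sym (leadingRun-∷ t w)))

restrict : ∀ {b G} (π : Automorphism (addVertex b G)) →
  _≅_.to π (inj₁ tt) ≡ inj₁ tt →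
  Σ[ ρ ∈ Automorphism G ] ∀ v → _≅_.to π (inj₂ v) ≡ inj₂ (_≅_.to ρ v)
restrict {b} {G} π fixed = ρ , proj₂ ∘ forth
  where
  open _≅_ π
  open Inverse bijection using (strictlyInverseˡ; strictlyInverseʳ)

  forth : ∀ v → ∃ λ w → to (inj₂ v) ≡ inj₂ w
  forth v = ≢inj₁⇒inj₂ _ λ eq →
    contradiction (↔-injective bijection (trans eq (sym fixed))) λ ()

  back : ∀ v → ∃ λ w → from (inj₂ v) ≡ inj₂ w
  back v = ≢inj₁⇒inj₂ _ λ eq → contradiction
    (trans (sym (strictlyInverseˡ (inj₂ v))) (trans (cong to eq) fixed)) λ ()

  ρ : Automorphism G
  ρ = record
    { bijection = mk↔ₛ′ (proj₁ ∘ forth) (proj₁ ∘ back)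
        (λ v → inj₂-injective (trans (sym (proj₂ (forth _)))
          (trans (cong to (sym (proj₂ (back v)))) (strictlyInverseˡ (inj₂ v)))))
        (λ v → inj₂-injective (trans (sym (proj₂ (back _)))
          (trans (cong from (sym (proj₂ (forth v)))) (strictlyInverseʳ (inj₂ v)))))
    ; adjacency = λ u v → ⇔-trans (adjacency (inj₂ u) (inj₂ v))
        (≡⇒⇔ (cong₂ (Adj (addVertex b G)) (proj₂ (forth u)) (proj₂ (forth v))))
    }

label-rigid : ∀ w (π : Automorphism (wordGraph w)) →
  (∀ v → label w v ≡ label w (_≅_.to π v)) → ∀ v → _≅_.to π v ≡ v
label-rigid []      π preserved v = subsingleton (completeGraph 1) ℕ.≤-refl _ v
label-rigid (t ∷ w) π preserved   = all-fixed
  where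
  open _≅_ π
  open Inverse bijection using (strictlyInverseˡ; strictlyInverseʳ)

  -- The image of the outermost vertex is again extreme of type `t`; as an inner vertex it would
  -- carry a label strictly below `leadingRun t w`.
  old-impossible : ∀ v → to (inj₁ tt) ≢ inj₂ v
  old-impossible v eq = ℕ.<-irrefl
    (sym (trans (preserved (inj₁ tt)) (cong (label (t ∷ w)) eq)))
    (extreme⇒label< t w v (extreme-inner {t} {G = wordGraph w}
      (subst (Extreme t (wordGraph (t ∷ w))) eq
        (extreme-≅ {t} π (extreme-new {t} {wordGraph w})))))

  new-fixed : to (inj₁ tt) ≡ inj₁ tt
  new-fixed with to (inj₁ tt) in eq
  ... | inj₁ tt = refl
  ... | inj₂ v  = contradiction eq (old-impossible v)

  ρ = proj₁ (restrict π new-fixed)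

  π≗ρ : ∀ v → to (inj₂ v) ≡ inj₂ (_≅_.to ρ v)
  π≗ρ = proj₂ (restrict π new-fixed)

  all-fixed : ∀ v → to v ≡ v
  all-fixed (inj₁ tt) = new-fixed
  all-fixed (inj₂ v)  = trans (π≗ρ v) (cong inj₂
    (label-rigid w ρ
      (λ u → trans (preserved (inj₂ u)) (cong (label (t ∷ w)) (π≗ρ u))) v))

isDistinguishingNumber-wordGraph : ∀ w →
  IsDistinguishingNumber (wordGraph w) (longestRun w)
isDistinguishingNumber-wordGraph w =
  (φ , distinguishing-if-rigid φ λ π preserved → label-rigid w π λ v →
    Fin.fromℕ<-injective _ _ _ _ (preserved v)) ,
  λ c′ → twinFamily-bound (longestRun-twins w)
  where
  φ : Labeling (wordGraph w) (longestRun w)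
  φ v = fromℕ< (label<longestRun w v)

-- Words and compact decompositions

HasType : SplitGraph → Type → Set
HasType S t = typeOf S ≡ just t

trivial⇒hasType : ∀ S → Trivial (graph S) → ∃ (HasType S)
trivial⇒hasType S triv with trivial? (graph S)
... | yes _     = _ , refl
... | no  ¬triv = contradiction triv ¬triv

hasTypes : ∀ Ss → All (λ S → NonEmpty (graph S)) Ss →
  All (λ S → order (graph S) ≤ 1) Ss → ∃ (Pointwise HasType Ss)
hasTypes []       []         []         = [] , []
hasTypes (S ∷ Ss) (1≤ ∷ 1≤s) (≤1 ∷ ≤1s) =
  let t , has = trivial⇒hasType S (ℕ.≤-antisym ≤1 1≤)
      w , hass = hasTypes Ss 1≤s ≤1s
  in  t ∷ w , has ∷ hass

-- `typeOf` inspects `soleVertex` only; as there is no other vertex, its answer holds for every `u`.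
hasType⇒point : ∀ S {t} → HasType S t →
  Trivial (graph S) × (∀ u → u ∈ A S ⇔ T (dominates t))
hasType⇒point S has with trivial? (graph S)
... | yes triv with A? S (soleVertex (graph S) triv)
hasType⇒point S refl | yes triv | yes s∈A = triv , λ u →
  mk⇔ (λ _ → tt)
      (λ _ → subst (A S) (subsingleton (graph S) (ℕ.≤-reflexive triv) _ u) s∈A)
hasType⇒point S refl | yes triv | no s∉A = triv , λ u →
  mk⇔ (λ u∈A → s∉A (subst (A S) (subsingleton (graph S) (ℕ.≤-reflexive triv) u _) u∈A))
      (λ ())

trivial-↔ : ∀ G H → Trivial G → Trivial H → Vertex G ↔ Vertex H
trivial-↔ G H trivG trivH = mk↔ₛ′
  (λ _ → soleVertex H trivH) (λ _ → soleVertex G trivG)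
  (subsingleton H (ℕ.≤-reflexive trivH) _)
  (subsingleton G (ℕ.≤-reflexive trivG) _)

trivial⇒≅ : ∀ G → Trivial G → G ≅ completeGraph 1
trivial⇒≅ G triv = record
  { bijection = trivial-↔ G (completeGraph 1) triv refl
  ; adjacency = λ u v → mk⇔
      (λ e → contradiction e (irrefl G (subsingleton G (ℕ.≤-reflexive triv) u v)))
      (contradiction refl)
  }

⊚-point : ∀ S {t H K} → HasType S t → H ≅ K → S ⊚ H ≅ addVertex (dominates t) K
⊚-point S {t} {H} {K} has i = record
  { bijection = vertices
  ; adjacency = adj
  }
  where
  triv = proj₁ (hasType⇒point S has)
  A⇔   = proj₂ (hasType⇒point S has)

  vertices : Vertex (S ⊚ H) ↔ (⊤ ⊎ Vertex K)
  vertices = ↔-trans (trivial-↔ (graph S) (completeGraph 1) triv refl) Fin.1↔⊤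
             ⊎-↔ _≅_.bijection i

  adj : ∀ x y → Adj (S ⊚ H) x y ⇔
    Adj (addVertex (dominates t) K) (Inverse.to vertices x) (Inverse.to vertices y)
  adj (inj₁ u) (inj₁ v) = mk⇔
    (λ e → irrefl (graph S) (subsingleton (graph S) (ℕ.≤-reflexive triv) u v) e) λ ()
  adj (inj₁ u) (inj₂ _) = A⇔ u
  adj (inj₂ _) (inj₁ v) = A⇔ v
  adj (inj₂ u) (inj₂ v) = _≅_.adjacency i u v

compose-≅ : ∀ {Ss w} G₀ → Pointwise HasType Ss w → Trivial G₀ →
            compose (Ss ▷ G₀) ≅ wordGraph w
compose-≅ G₀ []                   triv = trivial⇒≅ G₀ triv
compose-≅ G₀ (_∷_ {x = S} has hs) triv = ⊚-point S has (compose-≅ G₀ hs triv)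

-- Block sizes of a word.

largestBlock : Blocks → ℕ
largestBlock (ps , q) = largestComponentSize (map upperComponent ps ▷ coreComponent q)

-- The first run is the core itself when no upper block precedes it.
data StartsWith (t : Type) (m : ℕ) : Blocks → Set₁ where
  inCore  : StartsWith t m ([] , run t m)
  inUpper : ∀ {ps q} → StartsWith t m (run t m ∷ ps , q)

order-runComponent : ∀ t m → order (graph (runComponent t m)) ≡ m
order-runComponent K₁ m = refl
order-runComponent S₁ m = refl

largestBlock-∷ : ∀ t m ps q →
  largestBlock (run t m ∷ ps , q) ≡ m ⊔ largestBlock (ps , q)
largestBlock-∷ t m ps q = trans
  (max-∷ (order (coreComponent q)) (order (graph (runComponent t m)))
    (map (λ S → order (graph S)) (map upperComponent ps)))
  (cong (_⊔ largestBlock (ps , q)) (order-runComponent t m))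

lengthen-same : ∀ {X} t m → lengthen {X} t (run t m) ≡ just (run t (suc m))
lengthen-same K₁ m = refl
lengthen-same S₁ m = refl

-- Lengthening a run replaces `m` by `suc m` among the block sizes, whereas `longestRun` keeps both;
-- the smaller one is absorbed.
suc-⊔ : ∀ m n → suc m ⊔ n ≡ suc m ⊔ (m ⊔ n)
suc-⊔ m n = trans
  (cong (_⊔ n) (sym (ℕ.m≥n⇒m⊔n≡m (ℕ.n≤1+n m))))
  (ℕ.⊔-assoc (suc m) m n)

consTrivial-same : ∀ {t m B} → StartsWith t m B →
  StartsWith t (suc m) (consTrivial t B) ×
  largestBlock (consTrivial t B) ≡ suc m ⊔ largestBlock B
consTrivial-same {t} {m} inCore
  rewrite lengthen-same {Graph} t m | order-runComponent t m
        | order-runComponent t (suc m) =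
  inCore , sym (ℕ.m≥n⇒m⊔n≡m (ℕ.n≤1+n m))
consTrivial-same {t} {m} (inUpper {ps} {q})
  rewrite lengthen-same {SplitGraph} t m =
  inUpper , trans (largestBlock-∷ t (suc m) ps q)
    (trans (suc-⊔ m _) (cong (suc m ⊔_) (sym (largestBlock-∷ t m ps q))))

-- Matching on a constructor fixes both types, so that `lengthen` reduces to `nothing`.
data Opposite : Type → Type → Set where
  K₁S₁ : Opposite K₁ S₁
  S₁K₁ : Opposite S₁ K₁

consTrivial-other : ∀ {s t m B} → Opposite s t → StartsWith t m B →
  StartsWith s 1 (consTrivial s B) ×
  largestBlock (consTrivial s B) ≡ 1 ⊔ largestBlock B
consTrivial-other {m = m} K₁S₁ inCore             =
  inUpper , largestBlock-∷ K₁ 1 [] (run S₁ m)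
consTrivial-other {m = m} K₁S₁ (inUpper {ps} {q}) =
  inUpper , largestBlock-∷ K₁ 1 (run S₁ m ∷ ps) q
consTrivial-other {m = m} S₁K₁ inCore             =
  inUpper , largestBlock-∷ S₁ 1 [] (run K₁ m)
consTrivial-other {m = m} S₁K₁ (inUpper {ps} {q}) =
  inUpper , largestBlock-∷ S₁ 1 (run K₁ m ∷ ps) q

-- The induction invariant for `blocks`. The length of the first run accompanies the maximum because
-- the next letter may extend that run.
Encodes : Type → List Type → Blocks → Set₁
Encodes t w B = StartsWith t (leadingRun t (t ∷ w)) B × largestBlock B ≡ longestRun (t ∷ w)

consTrivial-encodes : ∀ s t w {B} → Encodes t w B → Encodes s (t ∷ w) (consTrivial s B)
consTrivial-encodes K₁ K₁ w (st , eq) = let st′ , eq′ = consTrivial-same st in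
  st′ , trans eq′ (cong (_ ⊔_) eq)
consTrivial-encodes K₁ S₁ w (st , eq) = let st′ , eq′ = consTrivial-other K₁S₁ st in
  st′ , trans eq′ (cong (_ ⊔_) eq)
consTrivial-encodes S₁ K₁ w (st , eq) = let st′ , eq′ = consTrivial-other S₁K₁ st in
  st′ , trans eq′ (cong (_ ⊔_) eq)
consTrivial-encodes S₁ S₁ w (st , eq) = let st′ , eq′ = consTrivial-same st in
  st′ , trans eq′ (cong (_ ⊔_) eq)

blocks-encode : ∀ {S Ss t w} G₀ → Trivial G₀ → Pointwise HasType (S ∷ Ss) (t ∷ w) →
                Encodes t w (blocks ((S ∷ Ss) ▷ G₀))
-- The core takes the type of the last upper component and forms a run of length 2 with it, in
-- agreement with the value 1 of `leadingRun` on the empty word.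
blocks-encode {t = K₁} G₀ triv (has ∷ [])
  rewrite has | dec-true (trivial? G₀) triv = inCore , refl
blocks-encode {t = S₁} G₀ triv (has ∷ [])
  rewrite has | dec-true (trivial? G₀) triv = inCore , refl
blocks-encode {t = s} {w = t ∷ w} G₀ triv (has ∷ hs@(_ ∷ _))
  rewrite has = consTrivial-encodes s t w (blocks-encode G₀ triv hs)

-- A core alone has no type and may be empty, so it is settled apart. Otherwise every component has
-- exactly one vertex, and `blocks-encode` identifies the value found for the word with the largest
-- block size.
isDistinguishingNumber-compose : ∀ Ss G₀ →
  All (λ S → NonEmpty (graph S)) Ss → (Ss ≢ [] → NonEmpty G₀) →
  All (λ S → order (graph S) ≤ 1) Ss → order G₀ ≤ 1 →
  IsDistinguishingNumber (compose (Ss ▷ G₀)) (largestBlock (blocks (Ss ▷ G₀)))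
isDistinguishingNumber-compose [] G₀ _ _ _ ≤1 = isDistinguishingNumber-order≤1 G₀ ≤1
isDistinguishingNumber-compose (S ∷ Ss) G₀ 1≤s 1≤ ≤1s ≤1 with hasTypes (S ∷ Ss) 1≤s ≤1s
... | t ∷ w , hs = subst (IsDistinguishingNumber _) (sym (proj₂ (blocks-encode G₀ triv hs)))
  (isDistinguishingNumber-≅ (compose-≅ G₀ hs triv) (isDistinguishingNumber-wordGraph (t ∷ w)))
  where
  triv : Trivial G₀
  triv = ℕ.≤-antisym ≤1 (1≤ λ ())

corollary3p5 : (G : Graph) → Threshold G → (d : CanonicalDecomposition G) →
    IsDistinguishingNumber G (largestComponentSize (compactCanonicalDecomposition d))
corollary3p5 G thr d =
  let Ss ▷ G₀  = components d
      ≤1s , ≤1 = components-order≤1 Ss G₀ thr (≅⇒⊑ (≅-sym (isomorphism d)))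
                   (upper-indecomposable d) (core-indecomposable d)
  in  isDistinguishingNumber-≅ (isomorphism d)
        (isDistinguishingNumber-compose Ss G₀
          (upper-nonEmpty d) (core-nonEmpty d) ≤1s ≤1)
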